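{- Suppose that $G$ is a 2-connected graph. Then $G$ admits $\sigma(G)\le 3$ with an optimal spanning tree $T$ if and only if (I) $T$ has diameter at most three ($T$ is a star or double star, which has no inner star-sets); or (II) each inner star-set $S$ of $T$ is a vertex cut of $G$ and for each $S$-component $H$ of $G$, the star-set $S$ is outer in $T\cap H$.
   Context: All graphs are simple and connected. For a spanning tree $T$ of $G$, $d_T(u,v)$ is the distance between $u$ and $v$ in $T$, $\sigma(G,T):=\max_{uv\in E(G)} d_T(u,v)$, and $\sigma(G):=\min\{\sigma(G,T): T \text{ is a spanning tree of } G\}$. A spanning tree $T$ attaining this minimum, i.e. with $\sigma(G,T)=\sigma(G)$, is called an optimal spanning tree. A pendant vertex of a tree is a vertex incident with only one edge of it. A star is a tree of diameter two; a double star is a tree of diameter three. A vertex cut of $G$ is a set $S\subseteq V(G)$ with $G-S$ disconnected. If $S$ is a vertex cut of $G$ and $V_1,\dots,V_k$ are the vertex sets of the components of $G-S$, the induced subgraphs $G[S\cup V_i]$ are called the $S$-components of $G$. For a non-pendant vertex $v$ of $T$, the set $S=\{v\}\cup N_T(v)$ (where $N_T(v)$ is the set of neighbors of $v$ in $T$) is called a star-set of $T$ with center $v$. A vertex $u\in S\setminus\{v\}$ is a contact vertex of $S$ if it is not a pendant vertex of $T$. A star-set $S$ is outer if it has at most one contact vertex, and inner if it has at least two contact vertices. For an $S$-component $H$, $T\cap H$ is the part of $T$ in $H$ (vertex set $V(H)$, edge set $E(T)\cap E(H)$), and "$S$ is outer in $T\cap H$" means that $S$ has at most one contact vertex with respect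 to $T\cap H$, i.e. at most one vertex of $S\setminus\{v\}$ is non-pendant in $T\cap H$. -}

module Defs where

open import Data.Nat using (ℕ; zero; suc; _≤_)
open import Data.Fin using (Fin)
open import Data.Fin.Subset using (Subset; _∈_; _⊆_; _∩_; _∪_; ∁; ⁅_⁆; ∣_∣)
open import Data.Fin.Subset.Properties using (_∈?_; x∈p∩q⁺)
open import Data.List using (List; []; _∷_)
open import Data.List.Relation.Unary.Unique.Propositional using (Unique)
open import Data.Product using (∃!; ∃-syntax; Σ-syntax; _×_; _,_)
open import Data.Vec using (tabulate)
open import Function.Bundles using (_⇔_)
open import Level using (0ℓ)
open import Relation.Binary using (Rel; Decidable; Symmetric; Irreflexive)
open import Relation.Binary.PropositionalEquality using (_≡_; _≢_)
open import Relation.Nullary using (¬_; does)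
open import Relation.Nullary.Decidable using (_×-dec_)

-- The vertex set is a subset of Fin n, so that subgraphs (induced subgraphs,
-- spanning trees, intersections) of a Graph n are again of type Graph n.
record Graph (n : ℕ) : Set₁ where
  field
    V      : Subset n
    _∼_    : Rel (Fin n) 0ℓ
    _∼?_   : Decidable _∼_
    sym    : Symmetric _∼_
    irrefl : Irreflexive _≡_ _∼_
    ∼⇒∈    : ∀ {u v} → u ∼ v → u ∈ V

open Graph public using (V)

Adj : ∀ {n} → Graph n → Rel (Fin n) 0ℓ
Adj G = Graph._∼_ G

module _ {n : ℕ} where

  N : Graph n → Fin n → Subset n
  N G v = tabulate (λ w → does (Graph._∼?_ G v w))

  _[_] : Graph n → Subset n → Graph n
  G [ A ] = record
    { V      = V G ∩ A
    ; _∼_    = λ u v → u ∼ v × u ∈ A × v ∈ A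
    ; _∼?_   = λ u v → (u ∼? v) ×-dec ((u ∈? A) ×-dec (v ∈? A))
    ; sym    = λ (e , p , q) → sym e , q , p
    ; irrefl = λ eq (e , _) → irrefl eq e
    ; ∼⇒∈    = λ (e , p , _) → x∈p∩q⁺ (∼⇒∈ e , p)
    }
    where open Graph G hiding (V)

  _-_ : Graph n → Subset n → Graph n
  G - S = G [ ∁ S ]

  _∩ᵍ_ : Graph n → Graph n → Graph n
  G ∩ᵍ H = record
    { V      = V G ∩ V H
    ; _∼_    = λ u v → Adj G u v × Adj H u v
    ; _∼?_   = λ u v → (u G.∼? v) ×-dec (u H.∼? v)
    ; sym    = λ (e , f) → G.sym e , H.sym f
    ; irrefl = λ eq (e , _) → G.irrefl eq e
    ; ∼⇒∈    = λ (e , f) → x∈p∩q⁺ (G.∼⇒∈ e , H.∼⇒∈ f)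
    }
    where
    module G = Graph G
    module H = Graph H

  data Walk (G : Graph n) : Fin n → ℕ → Fin n → Set where
    stop : ∀ {u} → u ∈ V G → Walk G u zero u
    step : ∀ {u v w k} → Adj G u v → Walk G v k w → Walk G u (suc k) w

  visited : ∀ {G : Graph n} {u k v} → Walk G u k v → List (Fin n)
  visited {u = u} (stop _)   = u ∷ []
  visited {u = u} (step _ p) = u ∷ visited p

  Joined : Graph n → Rel (Fin n) 0ℓ
  Joined G u v = ∃[ k ] Walk G u k v

  -- The graph without vertices counts as connected, so deleting all the
  -- vertices of a graph does not disconnect it.
  Connected : Graph n → Set
  Connected G = ∀ {u v} → u ∈ V G → v ∈ V G → Joined G u v

  TwoConnected : Graph n → Set
  TwoConnected G = 3 ≤ ∣ V G ∣ × Connected G × (∀ {v} → v ∈ V G → Connected (G - ⁅ v ⁆))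

  -- A cycle is a path with at least three vertices whose ends are adjacent.
  Cycle : Graph n → Set
  Cycle G = ∃[ u ] ∃[ k ] ∃[ v ] Σ[ p ∈ Walk G u k v ]
              (Unique (visited p) × 2 ≤ k × Adj G v u)

  IsTree : Graph n → Set
  IsTree T = Connected T × ¬ Cycle T

  IsSpanningTree : Graph n → Graph n → Set
  IsSpanningTree G T = V T ≡ V G × (∀ {u v} → Adj T u v → Adj G u v) × IsTree T

IsMin IsMax : ∀ {ℓ} → (ℕ → Set ℓ) → ℕ → Set ℓ
IsMin P m = P m × (∀ {k} → P k → m ≤ k)
IsMax P m = P m × (∀ {k} → P k → k ≤ m)

-- Distance, diameter, σ(G,T) and σ(G) are given by their graphs:
-- "the value is d" rather than a function computing d.
module _ {n : ℕ} where

  IsDistance : Graph n → Fin n → Fin n → ℕ → Set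
  IsDistance G u v = IsMin (λ k → Walk G u k v)

  IsDiameter : Graph n → ℕ → Set
  IsDiameter G = IsMax (λ k → ∃[ u ] ∃[ v ] (u ∈ V G × v ∈ V G × IsDistance G u v k))

  -- σ(G,T)
  IsTreeStretch : Graph n → Graph n → ℕ → Set
  IsTreeStretch G T = IsMax (λ k → ∃[ u ] ∃[ v ] (Adj G u v × IsDistance T u v k))

  -- σ(G)
  IsStretch : Graph n → ℕ → Set₁
  IsStretch G = IsMin (λ k → ∃[ T ] (IsSpanningTree G T × IsTreeStretch G T k))

  IsOptimal : Graph n → Graph n → Set₁
  IsOptimal G T = IsSpanningTree G T × (∃[ s ] (IsTreeStretch G T s × IsStretch G s))

  IsPendant : Graph n → Fin n → Set
  IsPendant T u = ∃! _≡_ (λ w → Adj T u w)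

  IsVertexCut : Graph n → Subset n → Set
  IsVertexCut G S = S ⊆ V G × ¬ Connected (G - S)

  -- C is the vertex set of a component of F.
  IsComponent : Graph n → Subset n → Set
  IsComponent F C = ∃[ x ] (x ∈ V F × (∀ {y} → y ∈ C ⇔ Joined F x y))

  IsSComponent : Graph n → Subset n → Graph n → Set₁
  IsSComponent G S H = ∃[ C ] (IsComponent (G - S) C × H ≡ G [ S ∪ C ])

  starSet : Graph n → Fin n → Subset n
  starSet T v = ⁅ v ⁆ ∪ N T v

  -- The star-set S and its center v are kept apart from the graph T, because
  -- a star-set of T is also considered with respect to the subgraphs T ∩ H.
  IsContact : Graph n → Subset n → Fin n → Fin n → Set
  IsContact T S v u = u ∈ S × u ≢ v × ¬ IsPendant T u

  IsOuter : Graph n → Subset n → Fin n → Set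
  IsOuter T S v = ∀ {u w} → IsContact T S v u → IsContact T S v w → u ≡ w

  IsInner : Graph n → Subset n → Fin n → Set
  IsInner T S v = ∃[ u ] ∃[ w ] (u ≢ w × IsContact T S v u × IsContact T S v w)

  IsInnerStarSet : Graph n → Subset n → Fin n → Set
  IsInnerStarSet T S v = v ∈ V T × ¬ IsPendant T v × S ≡ starSet T v × IsInner T S v

  DiameterAtMostThree : Graph n → Set
  DiameterAtMostThree T = ∃[ d ] (IsDiameter T d × d ≤ 3)

  InnerStarSetsSeparate : Graph n → Graph n → Set₁
  InnerStarSetsSeparate G T =
    ∀ {S v} → IsInnerStarSet T S v →
      IsVertexCut G S × (∀ {H} → IsSComponent G S H → IsOuter (T ∩ᵍ H) S v)

{-# OPTIONS --safe #-}

-- If every edge of G has T-distance at most three, then an edge of G between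
-- vertices outside the star-set S = N_T[v] is bridged by a path of T avoiding v,
-- so each component of G - S lies in a single branch of T - v; this gives (II).
-- Conversely, let xy be an edge of G whose T-path x p₁ p₂ p₃ p₄ … y has length at
-- least four, and let S be the star-set centred at p₂.  The edge xy and the part
-- p₄ … y of the path avoid S, so x and p₄ lie in one component of G - S, and p₁
-- and p₃ are both contact vertices in the corresponding S-component.

module Submission where

open import Defs
open import Data.Empty using (⊥-elim)
open import Data.Fin using (Fin; zero; suc; toℕ; fromℕ<; _≟_)
open import Data.Fin.Properties using (any?; injective⇒≤; toℕ-fromℕ<)
open import Data.Fin.Subset using (Subset; _∈_; _∉_; _⊆_; _∪_; ∁; ⁅_⁆)
open import Data.Fin.Subset.Properties
  using (_∈?_; x∈p∩q⁺; x∈p∩q⁻; x∈p∪q⁺; x∈p∪q⁻; x∈⁅x⁆; x∈⁅y⁆⇒x≡y; x≢y⇒x∉⁅y⁆; x∉p⇒x∈∁p; x∈∁p⇒x∉p)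
open import Data.List using (List; []; _∷_; length; lookup)
open import Data.List.Membership.Propositional using () renaming (_∈_ to _∈ˡ_)
open import Data.List.Membership.Propositional.Properties using (∈-lookup)
import Data.List.Membership.DecPropositional as DecMembership
open import Data.List.Relation.Unary.All as All using (All; []; _∷_)
open import Data.List.Relation.Unary.All.Properties using (¬Any⇒All¬)
open import Data.List.Relation.Unary.AllPairs using ([]; _∷_)
open import Data.List.Relation.Unary.Any using (here; there)
open import Data.List.Relation.Unary.Unique.Propositional using (Unique)
open import Data.Nat using (ℕ; zero; suc; _+_; _≤_; _<_; z≤n; s≤s)
import Data.Nat.Properties as ℕ
open import Data.Product using (∃-syntax; Σ-syntax; _×_; _,_; proj₁; proj₂)
open import Data.Sum using (_⊎_; inj₁; inj₂; [_,_]′)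
open import Data.Vec using (tabulate)
open import Data.Vec.Properties using (lookup⇒[]=; []=⇒lookup; lookup∘tabulate)
open import Function using (_∘_)
open import Function.Bundles using (_⇔_; mk⇔; Equivalence)
open import Relation.Binary.PropositionalEquality using (_≡_; _≢_; refl; sym; trans; cong; subst)
open import Relation.Nullary using (¬_; Dec; yes; no; does)
open import Relation.Nullary.Decidable using (_×-dec_; ¬?; dec-true; map′; decidable-stable)
open import Relation.Unary using (Pred; Decidable)

-- Extremal values of decidable predicates on numbers.

least : ∀ {p} {P : ℕ → Set p} → Decidable P → ∀ {k} → P k → ∃[ m ] IsMin P m
least P? {zero}  p = zero , p , λ _ → z≤n
least {P = P} P? {suc k} p with P? zero
... | yes p₀ = zero , p₀ , λ _ → z≤n
... | no ¬p₀ with least (P? ∘ suc) p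
...   | m , pₘ , min = suc m , pₘ , λ { {zero} p₀ → ⊥-elim (¬p₀ p₀) ; {suc _} q → s≤s (min q) }

greatest : ∀ {p} {P : ℕ → Set p} → Decidable P → ∀ b → (∀ {k} → P k → k ≤ b) →
           ∀ {k} → P k → ∃[ m ] IsMax P m
greatest P? b bound p with P? b
... | yes p_b = b , p_b , bound
greatest {P = P} P? zero bound p | no ¬p₀ = ⊥-elim (¬p₀ (subst P (ℕ.n≤0⇒n≡0 (bound p)) p))
greatest {P = P} P? (suc b) bound p | no ¬p_b = greatest P? b
  (λ q → ℕ.≤-pred (ℕ.≤∧≢⇒< (bound q) λ { refl → ¬p_b q })) p

-- Minimality ranges over all numbers, yet one witness bounds the search: `least` finds the true
-- minimum, and `k` is compared with it.
isMin? : ∀ {p} {P : ℕ → Set p} → Decidable P → Decidable (IsMin P)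
isMin? {P = P} P? k with P? k
... | no ¬p = no (¬p ∘ proj₁)
... | yes p with least P? p
...   | m , isMin = map′ (λ { refl → isMin })
                         (λ isMin′ → ℕ.≤-antisym (proj₂ isMin′ (proj₁ isMin)) (proj₂ isMin p))
                         (k ℕ.≟ m)

lookup-injective : ∀ {a} {A : Set a} {xs : List A} → Unique xs →
                   ∀ {i j} → lookup xs i ≡ lookup xs j → i ≡ j
lookup-injective (_ ∷ _) {zero}  {zero}  _ = refl
lookup-injective (x∉ ∷ _) {zero}  {suc j} eq = ⊥-elim (All.lookup x∉ (∈-lookup j) eq)
lookup-injective (x∉ ∷ _) {suc i} {zero}  eq = ⊥-elim (All.lookup x∉ (∈-lookup i) (sym eq))
lookup-injective (_ ∷ uniq) {suc i} {suc j} eq = cong suc (lookup-injective uniq eq)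

module _ {n : ℕ} where

  ∈-tabulate⁺ : ∀ {p} {P : Pred (Fin n) p} (P? : Decidable P) {x} → P x → x ∈ tabulate (does ∘ P?)
  ∈-tabulate⁺ P? {x} p = lookup⇒[]= x _ (trans (lookup∘tabulate _ x) (dec-true (P? x) p))

  ∈-tabulate⁻ : ∀ {p} {P : Pred (Fin n) p} (P? : Decidable P) {x} → x ∈ tabulate (does ∘ P?) → P x
  ∈-tabulate⁻ P? {x} x∈ with P? x | trans (sym (lookup∘tabulate (does ∘ P?) x)) ([]=⇒lookup x∈)
  ... | yes p | _  = p
  ... | no _  | ()

  ≢⇒∈∁ : ∀ {x v : Fin n} → x ≢ v → x ∈ ∁ ⁅ v ⁆
  ≢⇒∈∁ = x∉p⇒x∈∁p ∘ x≢y⇒x∉⁅y⁆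

  ∈∁⇒≢ : ∀ {x v : Fin n} → x ∈ ∁ ⁅ v ⁆ → x ≢ v
  ∈∁⇒≢ x∈ refl = x∈∁p⇒x∉p x∈ (x∈⁅x⁆ _)

  -- Walks, simple paths and joined vertices.

  module _ {F : Graph n} where

    private module F = Graph F

    walk-head : ∀ {u k v} → Walk F u k v → u ∈ V F
    walk-head (stop u∈)  = u∈
    walk-head (step e _) = F.∼⇒∈ e

    Joined-step : ∀ {u v w} → Adj F u v → Joined F v w → Joined F u w
    Joined-step e (k , p) = suc k , step e p

    Joined-edge : ∀ {u v} → Adj F u v → Joined F u v
    Joined-edge e = 1 , step e (stop (F.∼⇒∈ (F.sym e)))

    Joined-trans : ∀ {u v w} → Joined F u v → Joined F v w → Joined F u w
    Joined-trans (_ , stop _)   q = q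
    Joined-trans (_ , step e p) q = Joined-step e (Joined-trans (_ , p) q)

    Joined-sym : ∀ {u v} → Joined F u v → Joined F v u
    Joined-sym (_ , stop u∈)  = 0 , stop u∈
    Joined-sym (_ , step e p) = Joined-trans (Joined-sym (_ , p)) (Joined-edge (F.sym e))

    Path : Fin n → Fin n → Set
    Path u v = ∃[ k ] Σ[ p ∈ Walk F u k v ] Unique (visited p)

    visited⊆V : ∀ {u k v} (p : Walk F u k v) → All (_∈ V F) (visited p)
    visited⊆V (stop u∈)  = u∈ ∷ []
    visited⊆V (step e p) = F.∼⇒∈ e ∷ visited⊆V p

    suffix : ∀ {u k v x} (p : Walk F u k v) → Unique (visited p) → x ∈ˡ visited p → Path x v
    suffix (stop u∈)  uniq       (here refl) = _ , stop u∈ , uniq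
    suffix (step e p) uniq       (here refl) = _ , step e p , uniq
    suffix (step e p) (_ ∷ uniq) (there x∈)  = suffix p uniq x∈

    -- Loop erasure: if `u` already occurs on the path obtained from the rest of the walk, only the
    -- suffix from `u` is kept.
    toPath : ∀ {u v} → Joined F u v → Path u v
    toPath (_ , stop u∈) = _ , stop u∈ , [] ∷ []
    toPath {u} (_ , step e p) with toPath (_ , p)
    ... | _ , q , uniq with DecMembership._∈?_ _≟_ u (visited q)
    ...   | yes u∈ = suffix q uniq u∈
    ...   | no  u∉ = _ , step e q , ¬Any⇒All¬ _ u∉ ∷ uniq

    length-visited : ∀ {u k v} (p : Walk F u k v) → length (visited p) ≡ suc k
    length-visited (stop _)   = refl
    length-visited (step _ p) = cong suc (length-visited p)

    -- Pigeonhole: a simple path lists `suc k` distinct elements of `Fin n`.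
    path-length< : ∀ {u k v} (p : Walk F u k v) → Unique (visited p) → k < n
    path-length< p uniq = subst (_≤ n) (length-visited p)
      (injective⇒≤ (lookup-injective uniq))

  walk? : ∀ (F : Graph n) u v → Decidable (λ k → Walk F u k v)
  walk? F u v zero = map′ (λ { (refl , u∈) → stop u∈ }) (λ { (stop u∈) → refl , u∈ })
                          ((u ≟ v) ×-dec (u ∈? V F))
  walk? F u v (suc k) = map′ (λ (_ , e , p) → step e p) (λ { (step e p) → _ , e , p })
                             (any? λ w → Graph._∼?_ F u w ×-dec walk? F w v k)

  -- Every walk shortens to a simple path with fewer than `n` edges, so finitely many lengths have
  -- to be tested.
  joined? : ∀ (F : Graph n) u v → Dec (Joined F u v)
  joined? F u v = map′ (λ (k , p) → toℕ k , p) short (any? {n} (walk? F u v ∘ toℕ))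
    where
    short : Joined F u v → ∃[ k ] Walk F u (toℕ {n} k) v
    short j with toPath j
    ... | k , p , uniq = fromℕ< k<n , subst (λ i → Walk F u i v) (sym (toℕ-fromℕ< k<n)) p
      where k<n = path-length< p uniq

  -- An edge may become a whole walk: edges of `G - S` are later replaced by walks of the tree.
  Joined-map : ∀ {F F′ : Graph n} → V F ⊆ V F′ → (∀ {a b} → Adj F a b → Joined F′ a b) →
               ∀ {u v} → Joined F u v → Joined F′ u v
  Joined-map V⊆ f (_ , stop u∈)  = 0 , stop (V⊆ u∈)
  Joined-map V⊆ f (_ , step e p) = Joined-trans (f e) (Joined-map V⊆ f (_ , p))

  -- A `Subset` is Boolean-valued, so the encoding rests on the decision `joined?`.
  component : Graph n → Fin n → Subset n
  component F x = tabulate (does ∘ joined? F x)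

  component-isComponent : ∀ (F : Graph n) {x} → x ∈ V F → IsComponent F (component F x)
  component-isComponent F {x} x∈ =
    x , x∈ , mk⇔ (∈-tabulate⁻ (joined? F x)) (∈-tabulate⁺ (joined? F x))

  distance : ∀ (F : Graph n) {u v} → Joined F u v → ∃[ d ] IsDistance F u v d
  distance F {u} {v} (_ , p) = least (walk? F u v) p

  -- Star-sets and pendant vertices.

  ∈-starSet⁺ : ∀ (T : Graph n) {v x} → x ≡ v ⊎ Adj T v x → x ∈ starSet T v
  ∈-starSet⁺ T (inj₁ refl) = x∈p∪q⁺ (inj₁ (x∈⁅x⁆ _))
  ∈-starSet⁺ T (inj₂ e)    = x∈p∪q⁺ (inj₂ (∈-tabulate⁺ (Graph._∼?_ T _) e))

  ∈-starSet⁻ : ∀ (T : Graph n) {v x} → x ∈ starSet T v → x ≡ v ⊎ Adj T v x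
  ∈-starSet⁻ T {v} x∈ with x∈p∪q⁻ ⁅ v ⁆ (N T v) x∈
  ... | inj₁ x∈⁅v⁆ = inj₁ (x∈⁅y⁆⇒x≡y _ x∈⁅v⁆)
  ... | inj₂ x∈N   = inj₂ (∈-tabulate⁻ (Graph._∼?_ T v) x∈N)

  starSet-≢⇒Adj : ∀ (T : Graph n) {v x} → x ∈ starSet T v → x ≢ v → Adj T v x
  starSet-≢⇒Adj T x∈ x≢v = [ ⊥-elim ∘ x≢v , (λ e → e) ]′ (∈-starSet⁻ T x∈)

  nonPendant⇒otherNeighbour : ∀ (T : Graph n) {u v} → ¬ IsPendant T u → Adj T u v →
                              ∃[ w ] (w ≢ v × Adj T u w)
  nonPendant⇒otherNeighbour T {u} {v} ¬pendant e
    with any? (λ w → ¬? (w ≟ v) ×-dec Graph._∼?_ T u w)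
  ... | yes found = found
  ... | no  none  = ⊥-elim (¬pendant (v , e , λ {y} f →
                      sym (decidable-stable (y ≟ v) λ y≢v → none (y , y≢v , f))))

  twoNeighbours⇒nonPendant : ∀ (T : Graph n) {u v w} → Adj T u v → Adj T u w → v ≢ w → ¬ IsPendant T u
  twoNeighbours⇒nonPendant T e f v≢w (_ , _ , uniq) = v≢w (trans (sym (uniq e)) (uniq f))

  -- Branches of an acyclic graph at a vertex.

  module _ (T : Graph n) (acyclic : ¬ Cycle T) where

    private module T = Graph T

    no-triangle : ∀ {a b c} → Adj T a b → Adj T b c → ¬ Adj T c a
    no-triangle ab bc ca = acyclic
      ( _ , _ , _ , step ab (step bc (stop (T.∼⇒∈ ca)))
      , ((λ a≡b → T.irrefl a≡b ab) ∷ (λ a≡c → T.irrefl (sym a≡c) ca) ∷ [])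
        ∷ ((λ b≡c → T.irrefl b≡c bc) ∷ []) ∷ [] ∷ []
      , s≤s (s≤s z≤n) , ca )

    -- A member `x` of the star-set other than `v` would be adjacent to `v` and close the triangle
    -- `v`, `u`, `x`.
    ∉-starSet : ∀ {v u x} → Adj T v u → Adj T u x → x ≢ v → x ∉ starSet T v
    ∉-starSet vu ux x≢v x∈ = no-triangle vu ux (T.sym (starSet-≢⇒Adj T x∈ x≢v))

    -- Keeping the same vertex list lets simplicity carry over from the restricted graph to `T`.
    visited-[] : ∀ {A u k v} (p : Walk (T [ A ]) u k v) →
                 Σ[ q ∈ Walk T u k v ] visited q ≡ visited p
    visited-[] {A} (stop u∈) = stop (proj₁ (x∈p∩q⁻ (V T) A u∈)) , refl
    visited-[] (step (e , _) p) with visited-[] p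
    ... | q , eq = step e q , cong (_ ∷_) eq

    -- A path from `u` to a different neighbour `w` that avoids `v` closes up through `v` to a
    -- cycle.
    branches-disjoint : ∀ {v u w} → Adj T v u → Adj T v w → Joined (T - ⁅ v ⁆) u w → u ≡ w
    branches-disjoint {v} vu vw j with toPath j
    ... | _ , stop _ , _ = refl
    -- A path with at least one edge, preceded by `v`, has the three or more vertices that `Cycle`
    -- demands.
    ... | _ , p@(step _ _) , uniq with visited-[] p
    ...   | q , eq = ⊥-elim (acyclic
      ( v , _ , _ , step vu q
      , All.map v≢ (subst (All _) (sym eq) (visited⊆V p)) ∷ subst Unique (sym eq) uniq
      , s≤s (s≤s z≤n) , T.sym vw ))
      where
      v≢ : ∀ {x} → x ∈ V (T - ⁅ v ⁆) → v ≢ x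
      v≢ x∈ v≡x = ∈∁⇒≢ (proj₂ (x∈p∩q⁻ (V T) _ x∈)) (sym v≡x)

  -- On at most three edges every inner vertex is adjacent to an end, and neither end is `v` or
  -- adjacent to it.
  walk≤3-avoids-centre : ∀ (T : Graph n) {v a k b} → Walk T a k b → k ≤ 3 →
                         a ∉ starSet T v → b ∉ starSet T v → Joined (T - ⁅ v ⁆) a b
  walk≤3-avoids-centre T {v} {a} {b = b} p k≤3 a∉ b∉ = go p k≤3
    where
    module T = Graph T
    distinct : ∀ {x} → x ∉ starSet T v → x ∈ ∁ ⁅ v ⁆
    distinct x∉ = ≢⇒∈∁ (x∉ ∘ ∈-starSet⁺ T ∘ inj₁)
    neighbour : ∀ {x y} → x ∉ starSet T v → Adj T x y → y ∈ ∁ ⁅ v ⁆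
    neighbour x∉ xy = ≢⇒∈∁ λ { refl → x∉ (∈-starSet⁺ T (inj₂ (T.sym xy))) }
    edge : ∀ {x y} → Adj T x y → x ∈ ∁ ⁅ v ⁆ → y ∈ ∁ ⁅ v ⁆ → Joined (T - ⁅ v ⁆) x y
    edge xy x∈ y∈ = Joined-edge (xy , x∈ , y∈)
    go : ∀ {k} → Walk T a k b → k ≤ 3 → Joined (T - ⁅ v ⁆) a b
    go (stop a∈) _ = 0 , stop (x∈p∩q⁺ (a∈ , distinct a∉))
    go (step ab (stop _)) _ = edge ab (distinct a∉) (distinct b∉)
    go (step ac (step cb (stop _))) _ =
      Joined-step (ac , distinct a∉ , neighbour a∉ ac) (edge cb (neighbour a∉ ac) (distinct b∉))
    go (step ac (step cd (step db (stop _)))) _ =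
      Joined-step (ac , distinct a∉ , neighbour a∉ ac)
        (Joined-step (cd , neighbour a∉ ac , neighbour b∉ (T.sym db))
          (edge db (neighbour b∉ (T.sym db)) (distinct b∉)))
    go (step _ (step _ (step _ (step _ _)))) (s≤s (s≤s (s≤s ())))

  -- The bound σ(G,T) ≤ 3 stated edge by edge, so that no maximum has to be exhibited.
  EdgesWithinThree : Graph n → Graph n → Set
  EdgesWithinThree G T = ∀ {u v d} → Adj G u v → IsDistance T u v d → d ≤ 3

  module _ (G T : Graph n) (spanning : IsSpanningTree G T) where

    private
      module G = Graph G
      module T = Graph T
      V≡      = proj₁ spanning
      T⊆G     = proj₁ (proj₂ spanning)
      conn    = proj₁ (proj₂ (proj₂ spanning))
      acyclic = proj₂ (proj₂ (proj₂ spanning))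

    G⇒T-∈ : ∀ {x} → x ∈ V G → x ∈ V T
    G⇒T-∈ = subst (_ ∈_) (sym V≡)

    T⇒G-∈ : ∀ {x} → x ∈ V T → x ∈ V G
    T⇒G-∈ = subst (_ ∈_) V≡

    edge-distance : ∀ {u v} → Adj G u v → ∃[ d ] IsDistance T u v d
    edge-distance e = distance T (conn (G⇒T-∈ (G.∼⇒∈ e)) (G⇒T-∈ (G.∼⇒∈ (G.sym e))))

    -- From short edges to condition (II).

    module _ (short : EdgesWithinThree G T) where

      component⊆branch : ∀ {v a b} → Joined (G - starSet T v) a b → Joined (T - ⁅ v ⁆) a b
      component⊆branch {v} = Joined-map V⊆ edge
        where
        V⊆ : V (G - starSet T v) ⊆ V (T - ⁅ v ⁆)
        V⊆ x∈ with x∈p∩q⁻ (V G) _ x∈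
        ... | x∈G , x∈∁S = x∈p∩q⁺ ( G⇒T-∈ x∈G
                                  , ≢⇒∈∁ (x∈∁p⇒x∉p x∈∁S ∘ ∈-starSet⁺ T ∘ inj₁) )
        edge : ∀ {a b} → Adj (G - starSet T v) a b → Joined (T - ⁅ v ⁆) a b
        edge (e , a∈ , b∈) with edge-distance e
        ... | d , isDist = walk≤3-avoids-centre T (proj₁ isDist) (short e isDist)
                             (x∈∁p⇒x∉p a∈) (x∈∁p⇒x∉p b∈)

      -- A walk from `u` through `u′` and `w′` to `w` stays in one branch of `T` at `v`. Both halves
      -- of (II) rest on this.
      joined-neighbours⇒≡ : ∀ {v u w u′ w′} → Adj T v u → Adj T v w →
        Adj T u u′ → u′ ≢ v → Adj T w w′ → w′ ≢ v →
        Joined (G - starSet T v) u′ w′ → u ≡ w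
      joined-neighbours⇒≡ {v} vu vw uu′ u′≢v ww′ w′≢v j = branches-disjoint T acyclic vu vw
        (Joined-step (uu′ , centre≢ vu , ≢⇒∈∁ u′≢v)
          (Joined-trans (component⊆branch j)
            (Joined-edge (T.sym ww′ , ≢⇒∈∁ w′≢v , centre≢ vw))))
        where
        centre≢ : ∀ {x} → Adj T v x → x ∈ ∁ ⁅ v ⁆
        centre≢ vx = ≢⇒∈∁ λ x≡v → T.irrefl (sym x≡v) vx

      separate : InnerStarSetsSeparate G T
      separate {v = v} (v∈ , _ , refl , u , w , u≢w , (u∈S , u≢v , u-np) , (w∈S , w≢v , w-np)) =
        (S⊆V , disconnected) , outer
        where
        S = starSet T v
        S⊆V : S ⊆ V G
        S⊆V x∈ with ∈-starSet⁻ T x∈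
        ... | inj₁ refl = T⇒G-∈ v∈
        ... | inj₂ vx   = T⇒G-∈ (T.∼⇒∈ (T.sym vx))
        -- The contact vertices `u` and `w` have neighbours outside `S`; joining these in `G - S`
        -- would force `u ≡ w`.
        disconnected : ¬ Connected (G - S)
        disconnected connected
          with starSet-≢⇒Adj T u∈S u≢v | starSet-≢⇒Adj T w∈S w≢v
        ... | vu | vw
          with nonPendant⇒otherNeighbour T u-np (T.sym vu) | nonPendant⇒otherNeighbour T w-np (T.sym vw)
        ... | u′ , u′≢v , uu′ | w′ , w′≢v , ww′ =
          u≢w (joined-neighbours⇒≡ vu vw uu′ u′≢v ww′ w′≢v
                (connected (in-G-S vu uu′ u′≢v) (in-G-S vw ww′ w′≢v)))
          where
          in-G-S : ∀ {y x} → Adj T v y → Adj T y x → x ≢ v → x ∈ V (G - S)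
          in-G-S vy yx x≢v = x∈p∩q⁺ ( T⇒G-∈ (T.∼⇒∈ (T.sym yx))
                                    , x∉p⇒x∈∁p (∉-starSet T acyclic vy yx x≢v) )
        outer : ∀ {H} → IsSComponent G S H → IsOuter (T ∩ᵍ H) S v
        outer (C , (x , _ , C⇔) , refl) contact₁ contact₂
          with neighbour-in-C contact₁ | neighbour-in-C contact₂
          where
          -- The centre lies in the `S`-component, so a contact vertex has a second neighbour there;
          -- acyclicity keeps that neighbour out of `S`, which leaves `C`.
          neighbour-in-C : ∀ {y} → IsContact (T ∩ᵍ (G [ S ∪ C ])) S v y →
            Adj T v y × ∃[ y′ ] (Adj T y y′ × y′ ≢ v × Joined (G - S) x y′)
          neighbour-in-C {y} (y∈S , y≢v , y-np)
            with starSet-≢⇒Adj T y∈S y≢v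
          ... | vy with nonPendant⇒otherNeighbour (T ∩ᵍ (G [ S ∪ C ])) y-np
                          ( T.sym vy , T⊆G (T.sym vy) , x∈p∪q⁺ (inj₁ y∈S)
                          , x∈p∪q⁺ (inj₁ (∈-starSet⁺ T (inj₁ refl))) )
          ...   | y′ , y′≢v , yy′ , _ , _ , y′∈ with x∈p∪q⁻ S C y′∈
          ...     | inj₁ y′∈S = ⊥-elim (∉-starSet T acyclic vy yy′ y′≢v y′∈S)
          ...     | inj₂ y′∈C = vy , y′ , yy′ , y′≢v , Equivalence.to C⇔ y′∈C
        ... | vy , _ , yy′ , y′≢v , xy′ | vz , _ , zz′ , z′≢v , xz′ =
          joined-neighbours⇒≡ vy vz yy′ y′≢v zz′ z′≢v (Joined-trans (Joined-sym xy′) xz′)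

    -- From condition (II) to short edges.

    separate⇒short : InnerStarSetsSeparate G T → EdgesWithinThree G T
    separate⇒short sep {d = 0} _ _ = z≤n
    separate⇒short sep {d = 1} _ _ = s≤s z≤n
    separate⇒short sep {d = 2} _ _ = s≤s (s≤s z≤n)
    separate⇒short sep {d = 3} _ _ = ℕ.≤-refl
    separate⇒short sep {x} {y} {suc (suc (suc (suc d)))} xy
      (step {v = p₁} e₁ (step {v = p₂} e₂ (step {v = p₃} e₃ (step {v = p₄} e₄ p))) , min) =
      ⊥-elim (p₁≢p₃ (outer p₁-contact p₃-contact))
      where
      S = starSet T p₂
      y∈ : y ∈ V T
      y∈ = G⇒T-∈ (G.∼⇒∈ (G.sym xy))

      -- The walk through `p₁` to `p₄` realises the distance `4 + d`. Its position relative to `S`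
      -- is settled by exhibiting shorter walks.
      no-shortcut : ∀ {j} → Walk T x j y → ¬ j < 4 + d
      no-shortcut q = ℕ.≤⇒≯ (min q)

      x∉S : x ∉ S
      x∉S x∈ with ∈-starSet⁻ T x∈
      ... | inj₁ refl = no-shortcut (step e₃ (step e₄ p)) (ℕ.n≤1+n _)
      ... | inj₂ p₂x  = no-shortcut (step (T.sym p₂x) (step e₃ (step e₄ p))) ℕ.≤-refl

      -- From `x`, two edges lead to `a` if it is `p₂`, and three if it is adjacent to `p₂`; as
      -- `j ≤ d`, either way `y` is reached in fewer than `4 + d` edges.
      tail∉S : ∀ {a j} → Walk T a j y → j ≤ d → a ∉ S
      tail∉S q j≤d a∈ with ∈-starSet⁻ T a∈
      ... | inj₁ refl = no-shortcut (step e₁ (step e₂ q)) (s≤s (s≤s (s≤s (ℕ.m≤n⇒m≤1+n j≤d))))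
      ... | inj₂ p₂a  = no-shortcut (step e₁ (step e₂ (step p₂a q))) (s≤s (s≤s (s≤s (s≤s j≤d))))

      tail : ∀ {a j} → Walk T a j y → j ≤ d → Joined (G - S) a y
      tail q@(stop a∈) j≤d = 0 , stop (x∈p∩q⁺ (T⇒G-∈ a∈ , x∉p⇒x∈∁p (tail∉S q j≤d)))
      tail q@(step e r) j≤d = Joined-step
        (T⊆G e , x∉p⇒x∈∁p (tail∉S q j≤d) , x∉p⇒x∈∁p (tail∉S r (ℕ.<⇒≤ j≤d)))
        (tail r (ℕ.<⇒≤ j≤d))

      x∈G-S : x ∈ V (G - S)
      x∈G-S = x∈p∩q⁺ (G.∼⇒∈ xy , x∉p⇒x∈∁p x∉S)

      x-p₄ : Joined (G - S) x p₄
      x-p₄ = Joined-trans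
        (Joined-edge (xy , x∉p⇒x∈∁p x∉S , x∉p⇒x∈∁p (tail∉S (stop y∈) z≤n)))
        (Joined-sym (tail p ℕ.≤-refl))

      p₁≢p₃ : p₁ ≢ p₃
      p₁≢p₃ refl = no-shortcut (step e₁ (step e₄ p)) (ℕ.n≤1+n _)

      x≢p₂ : x ≢ p₂
      x≢p₂ = x∉S ∘ ∈-starSet⁺ T ∘ inj₁

      p₄≢p₂ : p₄ ≢ p₂
      p₄≢p₂ = tail∉S p ℕ.≤-refl ∘ ∈-starSet⁺ T ∘ inj₁

      p₁∈S : p₁ ∈ S
      p₁∈S = ∈-starSet⁺ T (inj₂ (T.sym e₂))

      p₃∈S : p₃ ∈ S
      p₃∈S = ∈-starSet⁺ T (inj₂ e₃)

      p₁≢p₂ : p₁ ≢ p₂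
      p₁≢p₂ eq = T.irrefl eq e₂

      p₃≢p₂ : p₃ ≢ p₂
      p₃≢p₂ eq = T.irrefl (sym eq) e₃

      inner : IsInnerStarSet T S p₂
      inner = T.∼⇒∈ e₃ , twoNeighbours⇒nonPendant T (T.sym e₂) e₃ p₁≢p₃ , refl
            , p₁ , p₃ , p₁≢p₃
            , (p₁∈S , p₁≢p₂ , twoNeighbours⇒nonPendant T (T.sym e₁) e₂ x≢p₂)
            , (p₃∈S , p₃≢p₂ , twoNeighbours⇒nonPendant T e₄ (T.sym e₃) p₄≢p₂)

      -- Taken around `x`, the component also contains `p₄` by `x-p₄`, so in `H` both `p₁` and `p₃`
      -- keep their neighbours away from `p₂`.
      C = component (G - S) x
      H = G [ S ∪ C ]

      ∈C : ∀ {a} → Joined (G - S) x a → a ∈ S ∪ C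
      ∈C j = x∈p∪q⁺ (inj₂ (∈-tabulate⁺ (joined? (G - S) x) j))

      ∈S : ∀ {a} → a ∈ S → a ∈ S ∪ C
      ∈S a∈ = x∈p∪q⁺ (inj₁ a∈)

      edge : ∀ {a b} → Adj T a b → a ∈ S ∪ C → b ∈ S ∪ C → Adj (T ∩ᵍ H) a b
      edge e a∈ b∈ = e , T⊆G e , a∈ , b∈

      p₂∈ : p₂ ∈ S ∪ C
      p₂∈ = ∈S (∈-starSet⁺ T (inj₁ refl))

      outer : IsOuter (T ∩ᵍ H) S p₂
      outer = proj₂ (sep inner) (C , component-isComponent (G - S) x∈G-S , refl)

      p₁-contact : IsContact (T ∩ᵍ H) S p₂ p₁
      p₁-contact = p₁∈S , p₁≢p₂ , twoNeighbours⇒nonPendant (T ∩ᵍ H)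
        (edge (T.sym e₁) (∈S p₁∈S) (∈C (0 , stop x∈G-S))) (edge e₂ (∈S p₁∈S) p₂∈) x≢p₂

      p₃-contact : IsContact (T ∩ᵍ H) S p₂ p₃
      p₃-contact = p₃∈S , p₃≢p₂ , twoNeighbours⇒nonPendant (T ∩ᵍ H)
        (edge e₄ (∈S p₃∈S) (∈C x-p₄)) (edge (T.sym e₃) (∈S p₃∈S) p₂∈) p₄≢p₂

    -- From the conditions to the value of the stretch.

    conditions⇒short : DiameterAtMostThree T ⊎ InnerStarSetsSeparate G T → EdgesWithinThree G T
    conditions⇒short (inj₁ (_ , (_ , max) , d≤3)) e isDist = ℕ.≤-trans
      (max (_ , _ , G⇒T-∈ (G.∼⇒∈ e) , G⇒T-∈ (G.∼⇒∈ (G.sym e)) , isDist)) d≤3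
    conditions⇒short (inj₂ sep) = separate⇒short λ {S} {v} → sep {S} {v}

    -- The edge supplies a first value; being an edge distance is decidable and bounded by three, so
    -- a search downwards from three finds the maximum.
    short⇒stretch≤3 : EdgesWithinThree G T → ∀ {u v} → Adj G u v → ∃[ s ] (IsTreeStretch G T s × s ≤ 3)
    short⇒stretch≤3 short e with greatest
      (λ k → any? λ u → any? λ v → (u G.∼? v) ×-dec isMin? (walk? T u v) k) 3
      (λ (_ , _ , e′ , isDist) → short e′ isDist) (_ , _ , e , proj₂ (edge-distance e))
    ... | s , isMax@((_ , _ , e′ , isDist) , _) = s , isMax , short e′ isDist

  -- Matches the value carried by `IsOptimal` with the given `σ`.
  IsStretch-unique : ∀ (G : Graph n) {s t} → IsStretch G s → IsStretch G t → s ≡ t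
  IsStretch-unique G (p , min) (q , min′) = ℕ.≤-antisym (min q) (min′ p)

  stretch≤3⇒separate : ∀ (G T : Graph n) {s} → IsSpanningTree G T → IsTreeStretch G T s → s ≤ 3 →
                       InnerStarSetsSeparate G T
  stretch≤3⇒separate G T spanning (_ , max) s≤3 {S} {v} = separate G T spanning
    (λ e isDist → ℕ.≤-trans (max (_ , _ , e , isDist)) s≤3) {S} {v}

-- Two readings of "with an optimal spanning tree" are proved: one for each optimal tree, one
-- existential.
theorem3p2 : ∀ {n : ℕ} (G : Graph n) → TwoConnected G →
    ∀ (σ : ℕ) → IsStretch G σ →
    (∀ (T : Graph n) → IsOptimal G T →
    (σ ≤ 3 ⇔ (DiameterAtMostThree T ⊎ InnerStarSetsSeparate G T)))
    × ((∃[ T ] (IsOptimal G T × σ ≤ 3))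
    ⇔ (∃[ T ] (IsSpanningTree G T × (DiameterAtMostThree T ⊎ InnerStarSetsSeparate G T))))
theorem3p2 {n} G _ σ isσ@((T₀ , spanning₀ , stretch₀@((_ , _ , e₀ , _) , _)) , σ-min) =
  (λ T optimal → mk⇔ (conditions T optimal) (σ≤3 T (proj₁ optimal))) ,
  mk⇔ (λ (T , optimal , σ≤3) → T , proj₁ optimal , conditions T optimal σ≤3)
      -- `T₀` attains `σ`, hence is optimal; the given `T` bounds `σ` by minimality.
      (λ (T , spanning , cond) → T₀ , (spanning₀ , σ , stretch₀ , isσ) , σ≤3 T spanning cond)
  where
  conditions : ∀ T → IsOptimal G T → σ ≤ 3 → DiameterAtMostThree T ⊎ InnerStarSetsSeparate G T
  conditions T (spanning , s , stretch , isS) σ≤3 = inj₂ λ {S} {v} → stretch≤3⇒separate G T spanning stretch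
    (subst (_≤ 3) (IsStretch-unique G isσ isS) σ≤3) {S} {v}

  σ≤3 : ∀ T → IsSpanningTree G T → DiameterAtMostThree T ⊎ InnerStarSetsSeparate G T → σ ≤ 3
  -- The edge `e₀`, which attains the stretch of `T₀`, also starts the search for the maximum over
  -- `T`.
  σ≤3 T spanning cond with short⇒stretch≤3 G T spanning (conditions⇒short G T spanning cond) e₀
  ... | s , stretch , s≤3 = ℕ.≤-trans (σ-min (T , spanning , stretch)) s≤3
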